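{- Let $\sigma\in A^u$. For all $P,Q\in C_{\alpha(\sigma)}$, $\mathrm{CP}_s\vdash P=Q$ if and only if $P=_{sse,\sigma}Q$, i.e. if and only if $sse_\sigma(P)=sse_\sigma(Q)$.
   Context: Let $A$ be a countable set (of atoms) with at least two elements. For $A'\subseteq A$, $C_{A'}$ is the set of closed terms (conditional statements) over the signature with constants $T$, $F$, a constant $a$ for each $a\in A'$, and one ternary operation $x\triangleleft y\triangleright z$ (the conditional, "if $y$ then $x$ else $z$"). $\mathrm{CP}$ is the set of equational axioms (in variables $x,y,z,u,v$): (CP1) $x\triangleleft T\triangleright y=x$; (CP2) $x\triangleleft F\triangleright y=y$; (CP3) $T\triangleleft x\triangleright F=x$; (CP4) $x\triangleleft(y\triangleleft z\triangleright u)\triangleright v=(x\triangleleft y\triangleright v)\triangleleft z\triangleright(x\triangleleft u\triangleright v)$. $\mathrm{CP}_s$ is $\mathrm{CP}$ extended with the axioms (CPmem) $x\triangleleft y\triangleright(z\triangleleft u\triangleright(v\triangleleft y\triangleright w))=x\triangleleft y\triangleright(z\triangleleft u\triangleright w)$ and (CPs) $F\triangleleft x\triangleright F=F$. For a set $E$ of equational axioms, $E\vdash s=t$ means derivability in equational logic from $E$. Evaluation trees: the set $\mathcal T_A$ is defined inductively by $T\in\mathcal T_A$, $F\in\mathcal T_A$, and $(X\trianglelefteq a\trianglerighteq Y)\in\mathcal T_A$ for all $X,Y\in\mathcal T_A$, $a\in A$ (binary tree with root $a$, left branch $X$, right branch $Y$). Leaf replacement: for $Y,Z\in\mathcal T_A$,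 $X[T\mapsto Y,F\mapsto Z]$ is defined by $T[T\mapsto Y,F\mapsto Z]=Y$, $F[T\mapsto Y,F\mapsto Z]=Z$, $(X_1\trianglelefteq a\trianglerighteq X_2)[T\mapsto Y,F\mapsto Z]=X_1[T\mapsto Y,F\mapsto Z]\trianglelefteq a\trianglerighteq X_2[T\mapsto Y,F\mapsto Z]$. The short-circuit evaluation function $se:C_A\to\mathcal T_A$ is defined by $se(T)=T$, $se(F)=F$, $se(a)=T\trianglelefteq a\trianglerighteq F$ for $a\in A$, and $se(P\triangleleft Q\triangleright R)=se(Q)[T\mapsto se(P),F\mapsto se(R)]$. Memorizing evaluation trees: for $a\in A$ define $L_a,R_a:\mathcal T_A\to\mathcal T_A$ by $L_a(B)=R_a(B)=B$ for $B\in\{T,F\}$; $L_a(X\trianglelefteq a\trianglerighteq Y)=L_a(X)$; $R_a(X\trianglelefteq a\trianglerighteq Y)=R_a(Y)$; and, if $b\neq a$, $L_a(X\trianglelefteq b\trianglerighteq Y)=L_a(X)\trianglelefteq b\trianglerighteq L_a(Y)$ and $R_a(X\trianglelefteq b\trianglerighteq Y)=R_a(X)\trianglelefteq b\trianglerighteq R_a(Y)$. Define $m:\mathcal T_A\to\mathcal T_A$ (by recursion on depth) by $m(T)=T$, $m(F)=F$, $m(X\trianglelefteq a\trianglerighteq Y)=m(L_a(X))\trianglelefteq a\trianglerighteq m(R_a(Y))$, and $mse(P)=m(se(P))$ for $P\in C_A$. Static evaluation trees: $A^u\subset A^*$ is the set of finite strings over $A$ (including the empty string $\epsilon$) containing no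 multiple occurrences of the same atom. $\alpha(\sigma)\subseteq A$ is the set of atoms occurring in $\sigma\in A^u$. For $\sigma\in A^u$ the conditional statement $E^\sigma$ is defined by $E^\epsilon=F$ and $E^{\rho a}=E^\rho\triangleleft a\triangleright E^\rho$. Then $sse_\sigma:C_{\alpha(\sigma)}\to\mathcal T_A$ is $sse_\sigma(P)=mse(T\triangleleft E^\sigma\triangleright P)$, and static valuation congruence over $\sigma$ on $C_{\alpha(\sigma)}$ is: $P=_{sse,\sigma}Q$ iff $sse_\sigma(P)=sse_\sigma(Q)$. -}

module Defs where

open import Data.Empty using (⊥)
open import Data.List.Base using (List; _∷ʳ_; foldl)
open import Data.List.Properties using (foldl-∷ʳ)
open import Data.List.Membership.Propositional using (_∈_)
open import Data.Nat.Base using (ℕ; suc; _≤_; z≤n; s≤s; _⊔_)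
import Data.Nat.Properties as ℕ
open import Function.Bundles using (_↣_)
open import Level using (Level)
open import Relation.Binary.Core using (Rel)
open import Relation.Binary.Definitions using (DecidableEquality)
open import Relation.Binary.PropositionalEquality using (_≡_; refl; cong₂)
open import Relation.Nullary.Decidable using (yes; no; via-injection)
open import Relation.Unary using (Pred)

private
  variable
    a ℓ : Level
    A : Set a
    V W : Set

------------------------------------------------------------------------
-- Conditional statements

-- x ◁ y ▷ z reads "if y then x else z".
data Term (A : Set a) (V : Set) : Set a where
  var   : V → Term A V
  T F   : Term A V
  atom  : A → Term A V
  _◁_▷_ : Term A V → Term A V → Term A V → Term A V

Closed : Set a → Set a
Closed A = Term A ⊥

-- C A′ is C_{A′}, as a subset of the closed terms over all of A.
data C {A : Set a} (A′ : Pred A ℓ) : Pred (Closed A) (a Level.⊔ ℓ) where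
  T    : C A′ T
  F    : C A′ F
  atom : ∀ {b} → A′ b → C A′ (atom b)
  cond : ∀ {P Q R} → C A′ P → C A′ Q → C A′ R → C A′ (P ◁ Q ▷ R)

_[_] : Term A V → (V → Term A W) → Term A W
var v       [ θ ] = θ v
T           [ θ ] = T
F           [ θ ] = F
atom b      [ θ ] = atom b
(s ◁ t ▷ u) [ θ ] = (s [ θ ]) ◁ (t [ θ ]) ▷ (u [ θ ])

-- A closed term viewed as an open term.
⌜_⌝ : Closed A → Term A V
⌜ P ⌝ = P [ (λ ()) ]

------------------------------------------------------------------------
-- Equational logic over countably many variables

infix 4 _⊢_≈_

data _⊢_≈_ {A : Set a} (E : Rel (Term A ℕ) ℓ) : Rel (Term A ℕ) (a Level.⊔ ℓ) where
  axiom      : ∀ {s t} → E s t → E ⊢ s ≈ t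
  reflexive  : ∀ {s} → E ⊢ s ≈ s
  symmetric  : ∀ {s t} → E ⊢ s ≈ t → E ⊢ t ≈ s
  transitive : ∀ {s t u} → E ⊢ s ≈ t → E ⊢ t ≈ u → E ⊢ s ≈ u
  congruence : ∀ {s s′ t t′ u u′} →
               E ⊢ s ≈ s′ → E ⊢ t ≈ t′ → E ⊢ u ≈ u′ →
               E ⊢ s ◁ t ▷ u ≈ s′ ◁ t′ ▷ u′
  substitute : ∀ {s t} (θ : ℕ → Term A ℕ) → E ⊢ s ≈ t → E ⊢ s [ θ ] ≈ t [ θ ]

private
  module Variables {A : Set a} where
    x y z u v w : Term A ℕ
    x = var 0
    y = var 1
    z = var 2
    u = var 3
    v = var 4
    w = var 5

open Variables

data CP {A : Set a} : Rel (Term A ℕ) a where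
  CP1 : CP (x ◁ T ▷ y) x
  CP2 : CP (x ◁ F ▷ y) y
  CP3 : CP (T ◁ x ▷ F) x
  CP4 : CP (x ◁ (y ◁ z ▷ u) ▷ v) ((x ◁ y ▷ v) ◁ z ▷ (x ◁ u ▷ v))

data CPₛ {A : Set a} : Rel (Term A ℕ) a where
  cp    : ∀ {s t} → CP s t → CPₛ s t
  CPmem : CPₛ (x ◁ y ▷ (z ◁ u ▷ (v ◁ y ▷ w))) (x ◁ y ▷ (z ◁ u ▷ w))
  CPs   : CPₛ (F ◁ x ▷ F) F

------------------------------------------------------------------------
-- Evaluation trees

data Tree (A : Set a) : Set a where
  T F   : Tree A
  _⊴_⊵_ : Tree A → A → Tree A → Tree A

_[T↦_,F↦_] : Tree A → Tree A → Tree A → Tree A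
T             [T↦ Y ,F↦ Z ] = Y
F             [T↦ Y ,F↦ Z ] = Z
(X₁ ⊴ b ⊵ X₂) [T↦ Y ,F↦ Z ] = (X₁ [T↦ Y ,F↦ Z ]) ⊴ b ⊵ (X₂ [T↦ Y ,F↦ Z ])

se : Closed A → Tree A
se (var ())
se T           = T
se F           = F
se (atom b)    = T ⊴ b ⊵ F
se (P ◁ Q ▷ R) = se Q [T↦ se P ,F↦ se R ]

depth : Tree A → ℕ
depth T           = 0
depth F           = 0
depth (X ⊴ b ⊵ Y) = suc (depth X ⊔ depth Y)

-- The empty string ε is [] and ρa is ρ ∷ʳ a.
α : {A : Set a} → List A → Pred A a
α σ b = b ∈ σ

-- The last atom of σ ends up at the root; see E-∷ʳ.
E^ : List A → Closed A
E^ = foldl (λ P b → P ◁ atom b ▷ P) F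

E-∷ʳ : (ρ : List A) (b : A) → E^ (ρ ∷ʳ b) ≡ E^ ρ ◁ atom b ▷ E^ ρ
E-∷ʳ ρ b = foldl-∷ʳ (λ P c → P ◁ atom c ▷ P) F b ρ

-- Countability of the atoms, as an injection into ℕ, makes their equality
-- decidable, which the case distinctions in L and R need.
countable⇒≟ : A ↣ ℕ → DecidableEquality A
countable⇒≟ A↣ℕ = via-injection A↣ℕ ℕ._≟_

module Memorizing {A : Set a} (_≟_ : DecidableEquality A) where

  L R : A → Tree A → Tree A
  L b T = T
  L b F = F
  L b (X ⊴ c ⊵ Y) with b ≟ c
  ... | yes _ = L b X
  ... | no  _ = L b X ⊴ c ⊵ L b Y
  R b T = T
  R b F = F
  R b (X ⊴ c ⊵ Y) with b ≟ c
  ... | yes _ = R b Y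
  ... | no  _ = R b X ⊴ c ⊵ R b Y

  depth-L : ∀ b (X : Tree A) → depth (L b X) ≤ depth X
  depth-L b T = z≤n
  depth-L b F = z≤n
  depth-L b (X ⊴ c ⊵ Y) with b ≟ c
  ... | yes _ = ℕ.m≤n⇒m≤1+n (ℕ.≤-trans (depth-L b X) (ℕ.m≤m⊔n _ _))
  ... | no  _ = s≤s (ℕ.⊔-mono-≤ (depth-L b X) (depth-L b Y))

  depth-R : ∀ b (X : Tree A) → depth (R b X) ≤ depth X
  depth-R b T = z≤n
  depth-R b F = z≤n
  depth-R b (X ⊴ c ⊵ Y) with b ≟ c
  ... | yes _ = ℕ.m≤n⇒m≤1+n (ℕ.≤-trans (depth-R b Y) (ℕ.m≤n⊔m _ _))
  ... | no  _ = s≤s (ℕ.⊔-mono-≤ (depth-R b X) (depth-R b Y))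

  -- m by recursion on a bound for the depth; m-node is its defining equation.
  m-bounded : ∀ n (X : Tree A) → depth X ≤ n → Tree A
  m-bounded n T _ = T
  m-bounded n F _ = F
  m-bounded (suc n) (X ⊴ b ⊵ Y) (s≤s d) =
    m-bounded n (L b X) (ℕ.≤-trans (depth-L b X) (ℕ.m⊔n≤o⇒m≤o _ _ d))
    ⊴ b ⊵
    m-bounded n (R b Y) (ℕ.≤-trans (depth-R b Y) (ℕ.m⊔n≤o⇒n≤o _ _ d))

  m : Tree A → Tree A
  m X = m-bounded (depth X) X ℕ.≤-refl

  m-bounded-irrelevant : ∀ {n k} (X : Tree A) (p : depth X ≤ n) (q : depth X ≤ k) →
                         m-bounded n X p ≡ m-bounded k X q
  m-bounded-irrelevant T _ _ = refl
  m-bounded-irrelevant F _ _ = refl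
  m-bounded-irrelevant {suc n} {suc k} (X ⊴ b ⊵ Y) (s≤s p) (s≤s q) =
    cong₂ (_⊴ b ⊵_) (m-bounded-irrelevant {n} {k} (L b X) _ _)
                    (m-bounded-irrelevant {n} {k} (R b Y) _ _)

  m-node : ∀ X b Y → m (X ⊴ b ⊵ Y) ≡ m (L b X) ⊴ b ⊵ m (R b Y)
  m-node X b Y = cong₂ (_⊴ b ⊵_) (m-bounded-irrelevant (L b X) _ _)
                                 (m-bounded-irrelevant (R b Y) _ _)

  mse : Closed A → Tree A
  mse P = m (se P)

  -- Only used on C (α σ), though the formula makes sense on all closed terms.
  sse : List A → Closed A → Tree A
  sse σ P = mse (T ◁ E^ σ ▷ P)

  _=sse[_]_ : Closed A → List A → Closed A → Set a
  P =sse[ σ ] Q = sse σ P ≡ sse σ Q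

{-# OPTIONS --safe #-}

-- In CPₛ the term E^ σ equals F, so every P equals T ◁ E^ σ ▷ P.  Every P also
-- equals the tree se P read as a term, and CPmem allows a tree to be replaced by
-- its memorizing normal form; hence P equals sse σ P read as a term, which gives
-- completeness.  For soundness, the axioms hold for two-valued valuations, so
-- provably equal P and Q agree under all valuations; and sse σ P is the perfect
-- tree over the distinct atoms of σ whose leaves are the values of P.
module Submission where

open import Defs
open import Data.Bool.Base using (Bool; true; false; if_then_else_)
open import Data.Empty using (⊥-elim)
open import Data.List.Base using (List; []; _∷_; foldl; foldr; reverse)
open import Data.List.Properties using (reverse-foldr)
open import Data.List.Relation.Binary.Permutation.Setoid.Properties
  using (Unique-resp-↭; ↭-reverse)
open import Data.List.Relation.Binary.Permutation.Setoid using (↭-sym)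
open import Data.List.Relation.Unary.All using (All; []; _∷_)
open import Data.List.Relation.Unary.AllPairs using ([]; _∷_)
open import Data.List.Relation.Unary.Any using (here; there)
open import Data.List.Relation.Unary.Any.Properties using (reverse⁺)
open import Data.List.Relation.Unary.Unique.Propositional using (Unique)
open import Data.Nat.Base using (ℕ; zero; suc; _≤_; s≤s)
import Data.Nat.Properties as ℕ
open import Data.Product.Base using (∃₂)
open import Function.Base using (const)
open import Function.Bundles using (_↣_; _⇔_; mk⇔)
open import Level using (Level; _⊔_)
open import Relation.Binary.Bundles using (Setoid)
open import Relation.Binary.Definitions using (DecidableEquality)
open import Relation.Binary.PropositionalEquality
  using (_≡_; _≢_; refl; sym; trans; cong; cong₂; subst; setoid; ≢-≟-identity;
         module ≡-Reasoning)
import Relation.Binary.Reasoning.Setoid as SetoidReasoning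
open import Relation.Nullary.Decidable using (yes; no; does; dec-true; dec-false)
open import Relation.Nullary.Negation using (contradiction)
open import Relation.Unary using (Pred; _∈_)

private
  variable
    a ℓ : Level
    A : Set a
    V W : Set

-- Equational reasoning in CPₛ

module _ {A : Set a} where

  CPₛ-setoid : Setoid a a
  CPₛ-setoid = record
    { Carrier = Term A ℕ
    ; _≈_ = CPₛ ⊢_≈_
    ; isEquivalence = record
      { refl = reflexive ; sym = symmetric ; trans = transitive }
    }

  open SetoidReasoning CPₛ-setoid

  private
    variable
      s t p q p′ q′ : Term A ℕ

  assign : List (Term A ℕ) → ℕ → Term A ℕ
  -- This default is never reached: every list passed below has a term for each variable of its
  -- axiom.
  assign []       _       = T
  assign (t ∷ _)  zero    = t
  assign (_ ∷ ts) (suc n) = assign ts n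

  instantiate : CPₛ s t → (ts : List (Term A ℕ)) →
                CPₛ ⊢ s [ assign ts ] ≈ t [ assign ts ]
  instantiate st ts = substitute (assign ts) (axiom st)

  ◁T▷ : ∀ x y → CPₛ ⊢ x ◁ T ▷ y ≈ x
  ◁T▷ x y = instantiate (cp CP1) (x ∷ y ∷ [])

  ◁F▷ : ∀ x y → CPₛ ⊢ x ◁ F ▷ y ≈ y
  ◁F▷ x y = instantiate (cp CP2) (x ∷ y ∷ [])

  T◁▷F : ∀ x → CPₛ ⊢ T ◁ x ▷ F ≈ x
  T◁▷F x = instantiate (cp CP3) (x ∷ [])

  ◁-assoc : ∀ x y z u v →
            CPₛ ⊢ x ◁ (y ◁ z ▷ u) ▷ v ≈ (x ◁ y ▷ v) ◁ z ▷ (x ◁ u ▷ v)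
  ◁-assoc x y z u v = instantiate (cp CP4) (x ∷ y ∷ z ∷ u ∷ v ∷ [])

  memorize : ∀ x y z u v w →
             CPₛ ⊢ x ◁ y ▷ (z ◁ u ▷ (v ◁ y ▷ w)) ≈ x ◁ y ▷ (z ◁ u ▷ w)
  memorize x y z u v w = instantiate CPmem (x ∷ y ∷ z ∷ u ∷ v ∷ w ∷ [])

  F◁▷F : ∀ x → CPₛ ⊢ F ◁ x ▷ F ≈ F
  F◁▷F x = instantiate CPs (x ∷ [])

  neg : Term A ℕ → Term A ℕ
  neg x = F ◁ x ▷ T

  -- CP4 distributes the outer conditional over the constant branches of `neg y`. This turns facts
  -- about right branches into facts about left ones.
  ◁neg▷ : ∀ x y z → CPₛ ⊢ x ◁ neg y ▷ z ≈ z ◁ y ▷ x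
  ◁neg▷ x y z = transitive (◁-assoc x F y T z)
                           (congruence (◁F▷ x z) reflexive (◁T▷ x z))

  -- The case `u = F` of `memorize`, in which CP2 removes the intermediate conditional.
  absorb : ∀ x y v w → CPₛ ⊢ x ◁ y ▷ (v ◁ y ▷ w) ≈ x ◁ y ▷ w
  absorb x y v w = begin
    x ◁ y ▷ (v ◁ y ▷ w)             ≈⟨ congruence reflexive reflexive (◁F▷ T _) ⟨
    x ◁ y ▷ (T ◁ F ▷ (v ◁ y ▷ w))   ≈⟨ memorize x y T F v w ⟩
    x ◁ y ▷ (T ◁ F ▷ w)             ≈⟨ congruence reflexive reflexive (◁F▷ T w) ⟩
    x ◁ y ▷ w                       ∎

  infix 4 _≈[_]_

  -- Interchangeability once `y` has been found false. The left branch is arbitrary, so the relation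
  -- applies below any test of `y`.
  _≈[_]_ : Term A ℕ → Term A ℕ → Term A ℕ → Set a
  p ≈[ y ] q = ∀ x → CPₛ ⊢ x ◁ y ▷ p ≈ x ◁ y ▷ q

  -- CPmem read backwards inserts a test of y right above p, where the hypothesis applies.
  ≈[]-congʳ : ∀ y z u → p ≈[ y ] q → (z ◁ u ▷ p) ≈[ y ] (z ◁ u ▷ q)
  ≈[]-congʳ {p} {q} y z u p≈q x = begin
    x ◁ y ▷ (z ◁ u ▷ p)             ≈⟨ memorize x y z u T p ⟨
    x ◁ y ▷ (z ◁ u ▷ (T ◁ y ▷ p))   ≈⟨ congruence reflexive reflexive
                                         (congruence reflexive reflexive (p≈q T)) ⟩
    x ◁ y ▷ (z ◁ u ▷ (T ◁ y ▷ q))   ≈⟨ memorize x y z u T q ⟩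
    x ◁ y ▷ (z ◁ u ▷ q)             ∎

  -- The mirror image of `≈[]-congʳ`, obtained with `neg u` as the inner condition.
  ≈[]-congˡ : ∀ y u z → p ≈[ y ] q → (p ◁ u ▷ z) ≈[ y ] (q ◁ u ▷ z)
  ≈[]-congˡ {p} {q} y u z p≈q x = begin
    x ◁ y ▷ (p ◁ u ▷ z)       ≈⟨ congruence reflexive reflexive (◁neg▷ z u p) ⟨
    x ◁ y ▷ (z ◁ neg u ▷ p)   ≈⟨ ≈[]-congʳ y z (neg u) p≈q x ⟩
    x ◁ y ▷ (z ◁ neg u ▷ q)   ≈⟨ congruence reflexive reflexive (◁neg▷ z u q) ⟩
    x ◁ y ▷ (q ◁ u ▷ z)       ∎

  ≈[]-cong : ∀ y u → p ≈[ y ] p′ → q ≈[ y ] q′ → (p ◁ u ▷ q) ≈[ y ] (p′ ◁ u ▷ q′)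
  ≈[]-cong y u p≈p′ q≈q′ x =
    transitive (≈[]-congˡ y u _ p≈p′ x) (≈[]-congʳ y _ u q≈q′ x)

-- Trees as terms

term : Tree A → Term A ℕ
term T           = T
term F           = F
term (X ⊴ b ⊵ Y) = term X ◁ atom b ▷ term Y

-- Leaf replacement is the conditional on trees: CP1 and CP2 account for the leaves, CP4 for the
-- nodes.
term-replace : (X Y Z : Tree A) →
               CPₛ ⊢ term (X [T↦ Y ,F↦ Z ]) ≈ term Y ◁ term X ▷ term Z
term-replace T             Y Z = symmetric (◁T▷ _ _)
term-replace F             Y Z = symmetric (◁F▷ _ _)
term-replace (X₁ ⊴ b ⊵ X₂) Y Z = transitive
  (congruence (term-replace X₁ Y Z) reflexive (term-replace X₂ Y Z))
  (symmetric (◁-assoc _ _ _ _ _))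

term-se : (P : Closed A) → CPₛ ⊢ term (se P) ≈ ⌜ P ⌝
term-se T           = reflexive
term-se F           = reflexive
term-se (atom b)    = T◁▷F _
term-se (P ◁ Q ▷ R) = transitive
  (term-replace (se Q) (se P) (se R))
  (congruence (term-se P) (term-se Q) (term-se R))

E^≈F : (σ : List A) → CPₛ ⊢ ⌜ E^ σ ⌝ ≈ F
E^≈F {A = A} σ = go F reflexive σ
  where
  -- The fold accumulates, so the claim is generalized to any start that equals `F`; CPs preserves
  -- this at each step.
  go : (P : Closed A) → CPₛ ⊢ ⌜ P ⌝ ≈ F → (σ : List A) →
       CPₛ ⊢ ⌜ foldl (λ P b → P ◁ atom b ▷ P) P σ ⌝ ≈ F
  go P P≈F []      = P≈F
  go P P≈F (b ∷ σ) =
    go _ (transitive (congruence P≈F reflexive P≈F) (F◁▷F _)) σ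

-- Two-valued semantics

⟦_⟧ : Term A V → (A → Bool) → (V → Bool) → Bool
⟦ var v ⟧     f g = g v
⟦ T ⟧         f g = true
⟦ F ⟧         f g = false
⟦ atom b ⟧    f g = f b
⟦ s ◁ t ▷ u ⟧ f g = if ⟦ t ⟧ f g then ⟦ s ⟧ f g else ⟦ u ⟧ f g

if-cong₃ : ∀ {b b′ x x′ y y′ : Bool} → b ≡ b′ → x ≡ x′ → y ≡ y′ →
           (if b then x else y) ≡ (if b′ then x′ else y′)
if-cong₃ refl refl refl = refl

module _ {A : Set a} (f : A → Bool) where

  ⟦⟧-subst : (s : Term A V) {θ : V → Term A W} {g : V → Bool} {h : W → Bool} →
             (∀ v → ⟦ θ v ⟧ f h ≡ g v) → ⟦ s [ θ ] ⟧ f h ≡ ⟦ s ⟧ f g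
  ⟦⟧-subst (var v)     eq = eq v
  ⟦⟧-subst T           eq = refl
  ⟦⟧-subst F           eq = refl
  ⟦⟧-subst (atom b)    eq = refl
  ⟦⟧-subst (s ◁ t ▷ u) eq =
    if-cong₃ (⟦⟧-subst t eq) (⟦⟧-subst s eq) (⟦⟧-subst u eq)

  -- Evaluation has no side effects here, so splitting on one variable used as a condition makes
  -- both sides compute to the same Boolean.
  CPₛ-valid : ∀ {s t : Term A ℕ} → CPₛ s t → ∀ g → ⟦ s ⟧ f g ≡ ⟦ t ⟧ f g
  CPₛ-valid (cp CP1) g = refl
  CPₛ-valid (cp CP2) g = refl
  CPₛ-valid (cp CP3) g with g 0
  ... | true  = refl
  ... | false = refl
  CPₛ-valid (cp CP4) g with g 2
  ... | true  = refl
  ... | false = refl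
  CPₛ-valid CPmem g with g 1
  ... | true  = refl
  ... | false = refl
  CPₛ-valid CPs g with g 0
  ... | true  = refl
  ... | false = refl

  ⊢-sound : ∀ {s t : Term A ℕ} → CPₛ ⊢ s ≈ t → ∀ g → ⟦ s ⟧ f g ≡ ⟦ t ⟧ f g
  ⊢-sound (axiom st)         g = CPₛ-valid st g
  ⊢-sound reflexive          g = refl
  ⊢-sound (symmetric d)      g = sym (⊢-sound d g)
  ⊢-sound (transitive d e)   g = trans (⊢-sound d g) (⊢-sound e g)
  ⊢-sound (congruence c d e) g = if-cong₃ (⊢-sound d g) (⊢-sound c g) (⊢-sound e g)
  ⊢-sound (substitute {s} {t} θ d) g = begin
    ⟦ s [ θ ] ⟧ f g                 ≡⟨ ⟦⟧-subst s (λ _ → refl) ⟩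
    ⟦ s ⟧ f (λ v → ⟦ θ v ⟧ f g)     ≡⟨ ⊢-sound d _ ⟩
    ⟦ t ⟧ f (λ v → ⟦ θ v ⟧ f g)     ≡⟨ ⟦⟧-subst t (λ _ → refl) ⟨
    ⟦ t [ θ ] ⟧ f g                 ∎
    where open ≡-Reasoning

  value : Tree A → Bool
  value T           = true
  value F           = false
  value (X ⊴ b ⊵ Y) = if f b then value X else value Y

  value-replace : ∀ X Y Z →
    value (X [T↦ Y ,F↦ Z ]) ≡ (if value X then value Y else value Z)
  value-replace T Y Z = refl
  value-replace F Y Z = refl
  value-replace (X₁ ⊴ b ⊵ X₂) Y Z with f b
  ... | true  = value-replace X₁ Y Z
  ... | false = value-replace X₂ Y Z

  value-se : (P : Closed A) → ∀ g → value (se P) ≡ ⟦ P ⟧ f g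
  value-se T        g = refl
  value-se F        g = refl
  value-se (atom b) g with f b
  ... | true  = refl
  ... | false = refl
  value-se (P ◁ Q ▷ R) g = trans
    (value-replace (se Q) (se P) (se R))
    (if-cong₃ (value-se Q g) (value-se P g) (value-se R g))

  ⊢⇒value≡ : (P Q : Closed A) → CPₛ ⊢ ⌜ P ⌝ ≈ ⌜ Q ⌝ → value (se P) ≡ value (se Q)
  ⊢⇒value≡ P Q d = begin
    value (se P)               ≡⟨ value-se P ⊥-elim ⟩
    -- Closed terms have no variables, so `const true` is an arbitrary choice of values for them.
    ⟦ P ⟧ f ⊥-elim             ≡⟨ ⟦⟧-subst P (λ ()) ⟨
    ⟦ ⌜ P ⌝ ⟧ f (const true)   ≡⟨ ⊢-sound d (const true) ⟩
    ⟦ ⌜ Q ⌝ ⟧ f (const true)   ≡⟨ ⟦⟧-subst Q (λ ()) ⟩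
    ⟦ Q ⟧ f ⊥-elim             ≡⟨ value-se Q ⊥-elim ⟨
    value (se Q)               ∎
    where open ≡-Reasoning

-- Trees over a set of atoms

data Over {A : Set a} (A′ : Pred A ℓ) : Pred (Tree A) (a ⊔ ℓ) where
  T    : Over A′ T
  F    : Over A′ F
  node : ∀ {X b Y} → Over A′ X → A′ b → Over A′ Y → Over A′ (X ⊴ b ⊵ Y)

module _ {A : Set a} {A′ : Pred A ℓ} where

  replace-over : ∀ {X Y Z} → Over A′ X → Over A′ Y → Over A′ Z →
                 Over A′ (X [T↦ Y ,F↦ Z ])
  replace-over T              oY oZ = oY
  replace-over F              oY oZ = oZ
  replace-over (node o₁ b o₂) oY oZ = node (replace-over o₁ oY oZ) b (replace-over o₂ oY oZ)

  se-over : ∀ {P} → P ∈ C A′ → Over A′ (se P)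
  se-over T            = T
  se-over F            = F
  se-over (atom b)     = node T b F
  se-over (cond P Q R) = replace-over (se-over Q) (se-over P) (se-over R)

over-map : ∀ {ℓ′} {A′ : Pred A ℓ} {A″ : Pred A ℓ′} → (∀ {b} → A′ b → A″ b) →
           ∀ {X} → Over A′ X → Over A″ X
over-map f T              = T
over-map f F              = F
over-map f (node oX b oY) = node (over-map f oX) (f b) (over-map f oY)

-- Perfect trees

perfect : List A → Tree A → Tree A
perfect τ X = foldr (λ b Y → Y ⊴ b ⊵ Y) X τ

-- All leaves of `se (E^ σ)` are `F`, so `se P` replaces each of them. The list is reversed because
-- `E^` puts its last atom at the root and `perfect` its first.
se-E^ : (σ : List A) (P : Closed A) → se (T ◁ E^ σ ▷ P) ≡ perfect (reverse σ) (se P)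
se-E^ {A = A} σ P = trans (go F σ) (sym (reverse-foldr _ (se P) σ))
  where
  go : (Q : Closed A) (σ : List A) →
       se (foldl (λ Q b → Q ◁ atom b ▷ Q) Q σ) [T↦ T ,F↦ se P ] ≡
       foldl (λ Y b → Y ⊴ b ⊵ Y) (se Q [T↦ T ,F↦ se P ]) σ
  go Q []      = refl
  go Q (b ∷ σ) = go (Q ◁ atom b ▷ Q) σ

-- Restriction to one value of an atom

-- The common graph of L b (v = true) and R b (v = false).
data Restriction {A : Set a} (v : Bool) (b : A) : Tree A → Tree A → Set a where
  T    : Restriction v b T T
  F    : Restriction v b F F
  skip : ∀ {X Y Z} → Restriction v b (if v then X else Y) Z →
         Restriction v b (X ⊴ b ⊵ Y) Z
  keep : ∀ {X X′ Y Y′ c} → b ≢ c → Restriction v b X X′ → Restriction v b Y Y′ →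
         Restriction v b (X ⊴ c ⊵ Y) (X′ ⊴ c ⊵ Y′)

module _ {A : Set a} where

  -- The literal that is false exactly when `b` has value `v`, since `_≈[_]_` concerns the branch
  -- where the condition fails.
  literal : Bool → A → Term A ℕ
  literal false b = atom b
  literal true  b = neg (atom b)

  -- A skipped node repeats a test whose outcome is known, so `absorb` removes it; a kept node is
  -- handled by congruence.
  restriction-≈[] : ∀ v {b : A} {X Y} → Restriction v b X Y →
                    term X ≈[ literal v b ] term Y
  restriction-≈[] v T x = reflexive
  restriction-≈[] v F x = reflexive
  restriction-≈[] false (skip r) x =
    transitive (absorb x _ _ _) (restriction-≈[] false r x)
  -- The branches are swapped first, so that the inner condition becomes the same negated literal as
  -- the outer one.
  restriction-≈[] true (skip {X} {Y} {Z} r) x = begin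
    x ◁ neg _ ▷ (term X ◁ _ ▷ term Y)       ≈⟨ congruence reflexive reflexive
                                                 (◁neg▷ (term Y) _ (term X)) ⟨
    x ◁ neg _ ▷ (term Y ◁ neg _ ▷ term X)   ≈⟨ absorb x _ (term Y) (term X) ⟩
    x ◁ neg _ ▷ term X                      ≈⟨ restriction-≈[] true r x ⟩
    x ◁ neg _ ▷ term Z                      ∎
    where open SetoidReasoning CPₛ-setoid
  restriction-≈[] v (keep _ r r′) x =
    ≈[]-cong (literal v _) _ (restriction-≈[] v r) (restriction-≈[] v r′) x

  -- The relation `_≈[_]_` rewrites right branches only, so the conditional is flipped while its
  -- left branch is replaced.
  term-restrict : ∀ {b : A} {X X′ Y Y′} →
                  Restriction true b X X′ → Restriction false b Y Y′ →
                  CPₛ ⊢ term (X ⊴ b ⊵ Y) ≈ term (X′ ⊴ b ⊵ Y′)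
  term-restrict {b} {X} {X′} {Y} {Y′} r r′ = begin
    term X ◁ atom b ▷ term Y         ≈⟨ ◁neg▷ (term Y) (atom b) (term X) ⟨
    term Y ◁ neg (atom b) ▷ term X   ≈⟨ restriction-≈[] true r (term Y) ⟩
    term Y ◁ neg (atom b) ▷ term X′  ≈⟨ ◁neg▷ (term Y) (atom b) (term X′) ⟩
    term X′ ◁ atom b ▷ term Y        ≈⟨ restriction-≈[] false r′ (term X′) ⟩
    term X′ ◁ atom b ▷ term Y′       ∎
    where open SetoidReasoning CPₛ-setoid

  -- Here `f′` is `f` with `b` set to `v`: it takes the surviving branch at skipped nodes and the
  -- same branch as `f` at kept ones.
  restriction-value : ∀ {f f′ : A → Bool} {v b} →
                      f′ b ≡ v → (∀ {c} → b ≢ c → f′ c ≡ f c) →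
                      ∀ {X Y} → Restriction v b X Y → value f Y ≡ value f′ X
  restriction-value f′b f′c T = refl
  restriction-value f′b f′c F = refl
  restriction-value {v = true}  f′b f′c (skip r) rewrite f′b = restriction-value f′b f′c r
  restriction-value {v = false} f′b f′c (skip r) rewrite f′b = restriction-value f′b f′c r
  restriction-value f′b f′c (keep b≢c r r′) =
    if-cong₃ (sym (f′c b≢c)) (restriction-value f′b f′c r) (restriction-value f′b f′c r′)

  restriction-over : ∀ {v} {b : A} {τ X Y} → Restriction v b X Y →
                     Over (α (b ∷ τ)) X → Over (α τ) Y
  restriction-over T o = T
  restriction-over F o = F
  restriction-over {true}  (skip r) (node oX _ oY) = restriction-over r oX
  restriction-over {false} (skip r) (node oX _ oY) = restriction-over r oY
  restriction-over (keep b≢c r r′) (node oX (here c≡b)  oY) = contradiction (sym c≡b) b≢c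
  restriction-over (keep b≢c r r′) (node oX (there c∈τ) oY) =
    node (restriction-over r oX) c∈τ (restriction-over r′ oY)

-- Memorizing normal forms and completeness

module _ {A : Set a} (_≟_ : DecidableEquality A) where

  open Memorizing _≟_

  L-restriction : ∀ b X → Restriction true b X (L b X)
  L-restriction b T = T
  L-restriction b F = F
  L-restriction b (X ⊴ c ⊵ Y) with b ≟ c
  ... | yes refl = skip (L-restriction b X)
  ... | no  b≢c  = keep b≢c (L-restriction b X) (L-restriction b Y)

  R-restriction : ∀ b X → Restriction false b X (R b X)
  R-restriction b T = T
  R-restriction b F = F
  R-restriction b (X ⊴ c ⊵ Y) with b ≟ c
  ... | yes refl = skip (R-restriction b Y)
  ... | no  b≢c  = keep b≢c (R-restriction b X) (R-restriction b Y)

  L-perfect : ∀ {b τ} X → All (b ≢_) τ → L b (perfect τ X) ≡ perfect τ (L b X)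
  L-perfect X []          = refl
  L-perfect X (b≢c ∷ b∉τ) rewrite ≢-≟-identity _≟_ b≢c =
    cong (λ Y → Y ⊴ _ ⊵ Y) (L-perfect X b∉τ)

  R-perfect : ∀ {b τ} X → All (b ≢_) τ → R b (perfect τ X) ≡ perfect τ (R b X)
  R-perfect X []          = refl
  R-perfect X (b≢c ∷ b∉τ) rewrite ≢-≟-identity _≟_ b≢c =
    cong (λ Y → Y ⊴ _ ⊵ Y) (R-perfect X b∉τ)

  term-m : ∀ X → CPₛ ⊢ term X ≈ term (m X)
  term-m X = go (depth X) X ℕ.≤-refl
    where
    -- Induction on the depth bound, following `m-bounded`, since `L b X` and `R b Y` need not be
    -- subtrees.
    go : ∀ n X (d : depth X ≤ n) → CPₛ ⊢ term X ≈ term (m-bounded n X d)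
    go n T _ = reflexive
    go n F _ = reflexive
    go (suc n) (X ⊴ b ⊵ Y) (s≤s d) = transitive
      (term-restrict (L-restriction b X) (R-restriction b Y))
      (congruence (go n (L b X) _) reflexive (go n (R b Y) _))

  term-sse : ∀ σ P → CPₛ ⊢ ⌜ P ⌝ ≈ term (sse σ P)
  term-sse σ P = begin
    ⌜ P ⌝                         ≈⟨ ◁F▷ T ⌜ P ⌝ ⟨
    T ◁ F ▷ ⌜ P ⌝                 ≈⟨ congruence reflexive (E^≈F σ) reflexive ⟨
    ⌜ T ◁ E^ σ ▷ P ⌝              ≈⟨ term-se (T ◁ E^ σ ▷ P) ⟨
    term (se (T ◁ E^ σ ▷ P))      ≈⟨ term-m (se (T ◁ E^ σ ▷ P)) ⟩
    term (sse σ P)                ∎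
    where open SetoidReasoning CPₛ-setoid

  =sse⇒⊢ : ∀ σ P Q → P =sse[ σ ] Q → CPₛ ⊢ ⌜ P ⌝ ≈ ⌜ Q ⌝
  =sse⇒⊢ σ P Q eq = transitive (term-sse σ P)
    (subst (λ X → CPₛ ⊢ term X ≈ ⌜ Q ⌝) (sym eq) (symmetric (term-sse σ Q)))

  -- Soundness through updated valuations

  _[_↦_] : (A → Bool) → A → Bool → A → Bool
  (f [ b ↦ v ]) c = if does (b ≟ c) then v else f c

  ↦-≡ : ∀ f b v → (f [ b ↦ v ]) b ≡ v
  ↦-≡ f b v rewrite dec-true (b ≟ b) refl = refl

  ↦-≢ : ∀ f b v {c} → b ≢ c → (f [ b ↦ v ]) c ≡ f c
  ↦-≢ f b v {c} b≢c rewrite dec-false (b ≟ c) b≢c = refl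

  -- The hypothesis at `f [ b ↦ v ]` gives the conclusion at `f`, because the restricted trees no
  -- longer test `b`.
  restriction-cong : ∀ {v b X X′ Y Y′} → Restriction v b X X′ → Restriction v b Y Y′ →
                     (∀ f → value f X ≡ value f Y) → ∀ f → value f X′ ≡ value f Y′
  restriction-cong {v} {b} {X} {X′} {Y} {Y′} r r′ X≈Y f = begin
    value f X′              ≡⟨ restriction-value (↦-≡ f b v) (↦-≢ f b v) r ⟩
    value (f [ b ↦ v ]) X   ≡⟨ X≈Y (f [ b ↦ v ]) ⟩
    value (f [ b ↦ v ]) Y   ≡⟨ restriction-value (↦-≡ f b v) (↦-≢ f b v) r′ ⟨
    value f Y′              ∎
    where open ≡-Reasoning

  -- As `b` does not occur in `τ`, restriction passes through all levels and acts only on the copies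
  -- of `X` at the bottom, so the perfect shape survives.
  m-perfect : ∀ {b τ} X → All (b ≢_) τ →
              m (perfect (b ∷ τ) X) ≡ m (perfect τ (L b X)) ⊴ b ⊵ m (perfect τ (R b X))
  m-perfect {b} {τ} X b∉τ = trans (m-node (perfect τ X) b (perfect τ X))
    (cong₂ (λ Y Z → m Y ⊴ b ⊵ m Z) (L-perfect X b∉τ) (R-perfect X b∉τ))

  -- Induction on `τ`: each level fixes one atom, and the restricted trees still agree in value over
  -- the remaining atoms. With no atoms left they are leaves, determined by their value.
  m-perfect-cong : ∀ {τ} → Unique τ →
                   ∀ {X Y} → Over (α τ) X → Over (α τ) Y →
                   (∀ f → value f X ≡ value f Y) → m (perfect τ X) ≡ m (perfect τ Y)
  m-perfect-cong [] T T X≈Y = refl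
  m-perfect-cong [] F F X≈Y = refl
  m-perfect-cong [] T F X≈Y = contradiction (X≈Y (const true)) λ ()
  m-perfect-cong [] F T X≈Y = contradiction (X≈Y (const true)) λ ()
  m-perfect-cong {b ∷ τ} (b∉τ ∷ u) {X} {Y} oX oY X≈Y = begin
    m (perfect (b ∷ τ) X)                               ≡⟨ m-perfect X b∉τ ⟩
    m (perfect τ (L b X)) ⊴ b ⊵ m (perfect τ (R b X))   ≡⟨ cong₂ (_⊴ b ⊵_)
      (ih (L-restriction b X) (L-restriction b Y)) (ih (R-restriction b X) (R-restriction b Y)) ⟩
    m (perfect τ (L b Y)) ⊴ b ⊵ m (perfect τ (R b Y))   ≡⟨ m-perfect Y b∉τ ⟨
    m (perfect (b ∷ τ) Y)                               ∎
    where
    open ≡-Reasoning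
    ih : ∀ {v X′ Y′} → Restriction v b X X′ → Restriction v b Y Y′ →
         m (perfect τ X′) ≡ m (perfect τ Y′)
    ih r r′ = m-perfect-cong u (restriction-over r oX) (restriction-over r′ oY)
                             (restriction-cong r r′ X≈Y)

  ⊢⇒=sse : ∀ σ → Unique σ → ∀ {P Q} → P ∈ C (α σ) → Q ∈ C (α σ) →
           CPₛ ⊢ ⌜ P ⌝ ≈ ⌜ Q ⌝ → P =sse[ σ ] Q
  ⊢⇒=sse σ u {P} {Q} P∈C Q∈C d = begin
    m (se (T ◁ E^ σ ▷ P))            ≡⟨ cong m (se-E^ σ P) ⟩
    m (perfect (reverse σ) (se P))   ≡⟨ m-perfect-cong
      (Unique-resp-↭ (setoid A) (↭-sym (setoid A) (↭-reverse (setoid A) σ)) u)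
      (over-map reverse⁺ (se-over P∈C)) (over-map reverse⁺ (se-over Q∈C))
      (λ f → ⊢⇒value≡ f P Q d) ⟩
    m (perfect (reverse σ) (se Q))   ≡⟨ cong m (se-E^ σ Q) ⟨
    m (se (T ◁ E^ σ ▷ Q))            ∎
    where open ≡-Reasoning

theorem6p16 : ∀ {a} (A : Set a) (countable : A ↣ ℕ) → (∃₂ λ (b c : A) → b ≢ c) →
    let open Memorizing (countable⇒≟ countable) in
    (σ : List A) → Unique σ →
    (P Q : Closed A) → P ∈ C (α σ) → Q ∈ C (α σ) →
    (CPₛ ⊢ ⌜ P ⌝ ≈ ⌜ Q ⌝) ⇔ (P =sse[ σ ] Q)
theorem6p16 A countable _ σ u P Q P∈C Q∈C =
  mk⇔ (⊢⇒=sse (countable⇒≟ countable) σ u P∈C Q∈C)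
      (=sse⇒⊢ (countable⇒≟ countable) σ P Q)
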